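{- For all integers $b\ge 2$, \[ F(b)\ge 2[b-1], \] where $2[m]$ denotes the power tower $2^{2^{\cdot^{\cdot^{2}}}}$ with $m$ occurrences of $2$.
   Context: All games are short normal-play two-player combinatorial games (Left and Right; a player unable to move loses), compared up to equality ($Y=Z$ iff $X+Y$ and $X+Z$ have the same outcome for every game $X$, $+$ being the disjunctive sum). The birthday of a game is the maximum length of a sequence of moves (not necessarily alternating) starting from it; a value is born by day $b$ if it equals some game of birthday at most $b$; $\mathbb{G}_b$ is the set of values born by day $b$. A Digraph placement game is played on a finite digraph with vertices coloured blue/red (not necessarily properly): Left chooses a remaining blue vertex and deletes it with all its out-neighbours, Right does the same with a red vertex; a player unable to move loses. For a game $X$, $f(X)$ is the least $n$ such that some Digraph placement game on $n$ vertices equals $X$, and $F(b)=\max_{X\in\mathbb{G}_b}f(X)$. For a real $r$ and integer $m\ge1$, $r[m]$ is the power tower $r^{r^{\cdot^{\cdot^{r}}}}$ with $r$ appearing $m$ times. -}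

module Defs where

open import Data.Nat using (ℕ; zero; suc; _+_; _^_; _⊔_; _≤_)
open import Data.Bool using (Bool; true; false; not; _∧_; _∨_)
open import Data.Fin using (Fin; zero; suc; splitAt; _≟_)
open import Data.Sum using ([_,_])
open import Data.Product using (Σ; _×_; _,_)
open import Data.List using (List; length; lookup; allFin; filterᵇ)
open import Relation.Nullary.Decidable using (⌊_⌋)
open import Relation.Binary.PropositionalEquality using (_≡_)

data Game : Set where
  mk : (l r : ℕ) → (Fin l → Game) → (Fin r → Game) → Game

_⊕_ : Game → Game → Game
mk lg rg gl gr ⊕ mk lh rh hl hr =
  mk (lg + lh) (rg + rh)
     (λ k → [ (λ i → gl i ⊕ mk lh rh hl hr) , (λ j → mk lg rg gl gr ⊕ hl j) ] (splitAt lg k))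
     (λ k → [ (λ i → gr i ⊕ mk lh rh hl hr) , (λ j → mk lg rg gl gr ⊕ hr j) ] (splitAt rg k))

anyFin : (n : ℕ) → (Fin n → Bool) → Bool
anyFin zero    p = false
anyFin (suc n) p = p zero ∨ anyFin n (λ i → p (suc i))

maxFin : (n : ℕ) → (Fin n → ℕ) → ℕ
maxFin zero    f = 0
maxFin (suc n) f = f zero ⊔ maxFin n (λ i → f (suc i))

mutual
  leftWinsFirst : Game → Bool
  leftWinsFirst (mk l r gl gr) = anyFin l (λ i → not (rightWinsFirst (gl i)))

  rightWinsFirst : Game → Bool
  rightWinsFirst (mk l r gl gr) = anyFin r (λ j → not (leftWinsFirst (gr j)))

Outcome : Set
Outcome = Bool × Bool

outcome : Game → Outcome
outcome G = leftWinsFirst G , rightWinsFirst G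

_≈_ : Game → Game → Set
Y ≈ Z = (X : Game) → outcome (X ⊕ Y) ≡ outcome (X ⊕ Z)

birthday : Game → ℕ
birthday (mk l r gl gr) =
  maxFin l (λ i → suc (birthday (gl i))) ⊔ maxFin r (λ j → suc (birthday (gr j)))

BornBy : ℕ → Game → Set
BornBy b X = Σ Game λ G → birthday G ≤ b × G ≈ X

record ColouredDigraph (n : ℕ) : Set where
  field
    blue : Fin n → Bool
    arc  : Fin n → Fin n → Bool

module _ {n : ℕ} (D : ColouredDigraph n) where
  open ColouredDigraph D

  deleteClosed : (Fin n → Bool) → Fin n → (Fin n → Bool)
  deleteClosed S v u = S u ∧ not (⌊ u ≟ v ⌋ ∨ arc v u)

  -- game of position S; fuel k must bound the number of remaining vertices
  -- (each move deletes at least one vertex)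
  dpgPos : ℕ → (Fin n → Bool) → Game
  dpgPos zero    S = mk 0 0 (λ ()) (λ ())
  dpgPos (suc k) S =
    mk (length Ls) (length Rs)
       (λ i → dpgPos k (deleteClosed S (lookup Ls i)))
       (λ j → dpgPos k (deleteClosed S (lookup Rs j)))
    where
      Ls : List (Fin n)
      Ls = filterᵇ (λ v → S v ∧ blue v) (allFin n)
      Rs : List (Fin n)
      Rs = filterᵇ (λ v → S v ∧ not (blue v)) (allFin n)

dpg : {n : ℕ} → ColouredDigraph n → Game
dpg {n} D = dpgPos D n (λ _ → true)

fAtLeast : Game → ℕ → Set
fAtLeast X m = (n : ℕ) (D : ColouredDigraph n) → dpg D ≈ X → m ≤ n

FAtLeast : ℕ → ℕ → Set
FAtLeast b m = Σ Game λ X → BornBy b X × fAtLeast X m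

-- power tower r[m]: r[1] = r, r[m+1] = r ^ r[m]  (r[0] = 1 by convention, unused)
tower : ℕ → ℕ → ℕ
tower r zero    = 1
tower r (suc m) = r ^ tower r m

{-# OPTIONS --safe #-}
module Submission where

-- Let X = {A₁,…,A_N | −c} with A an antichain of games born by day c, so that X is born by day c + 1.
--
-- For b ≤ 4, consider a digraph position H ≤ X.  Right threatens to move from H to some position ≤ −c, so
-- H has more than c red vertices.  If Aᵢ ⧏ H, Left has a move from H to some K ≥ Aᵢ; either K equals Aᵢ,
-- or K reverses through a position H′ ≤ X with Aᵢ ⧏ H′.  Deleting blue vertices lowers a position and
-- deleting red ones raises it, so Left's move must remove a red vertex to cancel the threat and Right's
-- reply must remove a blue one to renew it: each reversal costs two vertices of each colour.  This
-- bounds N by a product of few factors, and for c = 3 at most 63 options fit on 15 vertices, while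
-- there are suitable antichains of 64 games born by day 3.
--
-- For b ≥ 5 counting suffices.  The 2^N subsets of A give different games, told apart by which Aᵢ satisfy
-- Aᵢ ⧏ X, and there are fewer than 2^(n²) coloured digraphs with fewer than n vertices.  Large
-- antichains arise inductively: subsets that are pairwise incomparable under inclusion give
-- incomparable games.

open import Defs
open import Data.Bool using (Bool; true; false; not; T; _∧_; if_then_else_)
open import Data.Bool.Properties using (T-∧; T-∨)
open import Data.Empty using (⊥-elim)
open import Data.Fin using (Fin; zero; suc; toℕ; fromℕ<; inject≤; splitAt; _↑ˡ_; _↑ʳ_; combine; remQuot; funToFin; finToFun; _≟_)
open import Data.Fin.Properties using (all?; any?; ¬∀⟶∃¬; pigeonhole; suc-injective; splitAt-↑ˡ; splitAt-↑ʳ; inject≤-injective; toℕ-inject≤; toℕ-fromℕ<; fromℕ<-toℕ; fromℕ<-cong; toℕ<n; remQuot-combine; funToFin-finToFin; finToFun-funToFin; 2↔Bool)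
open import Data.List using (List; []; _∷_; [_]; _++_; length; lookup; allFin; filterᵇ; cartesianProductWith)
open import Data.List.Membership.Propositional using (_∈_)
open import Data.List.Membership.Propositional.Properties using (∈-filter⁺; ∈-filter⁻; ∈-lookup; ∈-allFin)
open import Data.List.Relation.Unary.Any using (index)
open import Data.List.Relation.Unary.Any.Properties using (lookup-index)
open import Data.Nat using (ℕ; zero; suc; _+_; _*_; _^_; _∸_; _⊔_; _≤_; _<_; _<ᵇ_; _≤?_; _<?_; z≤n; s≤s; s≤s⁻¹)
open import Data.Nat.Properties hiding (_≟_; suc-injective)
open import Data.Product using (∃; _×_; _,_; proj₁; proj₂)
open import Data.Sum as Sum using (_⊎_; inj₁; inj₂)
open import Data.Unit using (tt)
open import Function using (_∘_; id)
open import Function.Bundles using (_⇔_; mk⇔; Equivalence; Inverse)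
open import Relation.Nullary using (¬_; Dec; yes; no; contradiction)
open import Relation.Nullary.Decidable using (T?; ¬?; map′; _×-dec_; _→-dec_; ⌊_⌋; True; toWitness; fromWitness)
open import Relation.Binary.PropositionalEquality using (_≡_; _≢_; _≗_; refl; sym; trans; cong; cong₂; subst; subst₂; module ≡-Reasoning)

open ColouredDigraph
open Equivalence using (to; from)

-- The order on games

-- G ⧏ H says that Left, moving first, wins H − G.
infix 4 _≼_ _⧏_

mutual
  _≼_ : Game → Game → Set
  G@(mk _ _ gl _) ≼ H@(mk _ _ _ hr) = (∀ i → gl i ⧏ H) × (∀ j → G ⧏ hr j)

  _⧏_ : Game → Game → Set
  G@(mk _ _ _ gr) ⧏ H@(mk _ _ hl _) = (∃ λ j → gr j ≼ H) ⊎ (∃ λ i → G ≼ hl i)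

viaᴿ : ∀ {l r gl gr H} (j : Fin r) → gr j ≼ H → mk l r gl gr ⧏ H
viaᴿ {H = mk _ _ _ _} j p = inj₁ (j , p)

viaᴸ : ∀ {G l r hl hr} (i : Fin l) → G ≼ hl i → G ⧏ mk l r hl hr
viaᴸ {G = mk _ _ _ _} i p = inj₂ (i , p)

≼-refl : ∀ G → G ≼ G
≼-refl (mk l r gl gr) = (λ i → viaᴸ i (≼-refl (gl i))) , (λ j → viaᴿ j (≼-refl (gr j)))

mutual
  ≼-trans : ∀ {G H K} → G ≼ H → H ≼ K → G ≼ K
  ≼-trans {mk _ _ _ _} {mk _ _ _ _} {mk _ _ _ _} G≼H H≼K =
    (λ i → ⧏-≼-trans (proj₁ G≼H i) H≼K) , (λ j → ≼-⧏-trans G≼H (proj₂ H≼K j))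

  ⧏-≼-trans : ∀ {G H K} → G ⧏ H → H ≼ K → G ⧏ K
  ⧏-≼-trans {mk _ _ _ _} {mk _ _ _ _} {mk _ _ _ _} (inj₁ (j , Gʲ≼H)) H≼K =
    inj₁ (j , ≼-trans Gʲ≼H H≼K)
  ⧏-≼-trans {mk _ _ _ _} {mk _ _ _ _} {mk _ _ _ _} (inj₂ (i , G≼Hⁱ)) H≼K =
    ≼-⧏-trans G≼Hⁱ (proj₁ H≼K i)

  ≼-⧏-trans : ∀ {G H K} → G ≼ H → H ⧏ K → G ⧏ K
  ≼-⧏-trans {mk _ _ _ _} {mk _ _ _ _} {mk _ _ _ _} G≼H (inj₁ (j , Hʲ≼K)) =
    ⧏-≼-trans (proj₂ G≼H j) Hʲ≼K
  ≼-⧏-trans {mk _ _ _ _} {mk _ _ _ _} {mk _ _ _ _} G≼H (inj₂ (i , H≼Kⁱ)) =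
    inj₂ (i , ≼-trans G≼H H≼Kⁱ)

≼⇒¬⧏ : ∀ {G H} → G ≼ H → ¬ H ⧏ G
≼⇒¬⧏ {mk _ _ _ _} {mk _ _ _ _} G≼H (inj₁ (j , Hʲ≼G)) = ≼⇒¬⧏ Hʲ≼G (proj₂ G≼H j)
≼⇒¬⧏ {mk _ _ _ _} {mk _ _ _ _} G≼H (inj₂ (i , H≼Gⁱ)) = ≼⇒¬⧏ H≼Gⁱ (proj₁ G≼H i)

-- Outcomes of differences, decidability and equality

negate : Game → Game
negate (mk l r gl gr) = mk r l (negate ∘ gr) (negate ∘ gl)

T-not : ∀ {b} → T (not b) ⇔ (¬ T b)
T-not {true}  = mk⇔ (λ ()) (λ ¬t → ¬t tt)
T-not {false} = mk⇔ (λ _ ()) (λ _ → tt)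

T-anyFin : ∀ {n p} → T (anyFin n p) ⇔ (∃ λ i → T (p i))
T-anyFin {zero}      = mk⇔ (λ ()) (λ ())
T-anyFin {suc n} {p} = mk⇔ fwd bwd
  where
  fwd : T (anyFin (suc n) p) → ∃ λ i → T (p i)
  fwd t with to T-∨ t
  ... | inj₁ t₀ = zero , t₀
  ... | inj₂ t₁ with to T-anyFin t₁
  ...   | i , tᵢ = suc i , tᵢ
  bwd : (∃ λ i → T (p i)) → T (anyFin (suc n) p)
  bwd (zero  , t) = from T-∨ (inj₁ t)
  bwd (suc i , t) = from (T-∨ {p zero}) (inj₂ (from T-anyFin (i , t)))

T-anyFin-splitAt : ∀ {m n} (p : Game → Bool) (f : Fin m → Game) (g : Fin n → Game) →
  T (anyFin (m + n) (λ k → p (Sum.[ f , g ] (splitAt m k)))) ⇔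
  ((∃ λ i → T (p (f i))) ⊎ (∃ λ j → T (p (g j))))
T-anyFin-splitAt {m} {n} p f g = mk⇔ (λ t → fwd (to T-anyFin t)) (from T-anyFin ∘ bwd)
  where
  fwd : (∃ λ k → T (p (Sum.[ f , g ] (splitAt m k)))) → _
  fwd (k , t) with splitAt m k
  ... | inj₁ i = inj₁ (i , t)
  ... | inj₂ j = inj₂ (j , t)
  bwd : _ → ∃ λ k → T (p (Sum.[ f , g ] (splitAt m k)))
  bwd (inj₁ (i , t)) = i ↑ˡ n , subst (λ x → T (p (Sum.[ f , g ] x))) (sym (splitAt-↑ˡ m i n)) t
  bwd (inj₂ (j , t)) = m ↑ʳ j , subst (λ x → T (p (Sum.[ f , g ] x))) (sym (splitAt-↑ʳ m n j)) t

T-¬¬ : ∀ {b} → ¬ ¬ T b → T b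
T-¬¬ {true}  _   = tt
T-¬¬ {false} ¬¬t = ⊥-elim (¬¬t λ ())

mutual
  -- Left's moves in `negate G ⊕ H` are the Right options of `G` and the Left options of `H`, so the
  -- order unfolds exactly as the outcome does. With the converses below, comparisons become
  -- decidable by evaluation.
  ⧏⇒leftWinsFirst : ∀ G H → G ⧏ H → T (leftWinsFirst (negate G ⊕ H))
  ⧏⇒leftWinsFirst G@(mk l r gl gr) H@(mk l′ r′ hl hr) G⧏H =
    from (T-anyFin-splitAt (not ∘ rightWinsFirst) (λ j → negate (gr j) ⊕ H) (λ i → negate G ⊕ hl i))
      (Sum.map (λ (j , p) → j , from T-not (≼⇒¬rightWinsFirst (gr j) H p))
               (λ (i , p) → i , from T-not (≼⇒¬rightWinsFirst G (hl i) p)) G⧏H)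

  ≼⇒¬rightWinsFirst : ∀ G H → G ≼ H → ¬ T (rightWinsFirst (negate G ⊕ H))
  ≼⇒¬rightWinsFirst G@(mk l r gl gr) H@(mk l′ r′ hl hr) (p , q) t =
    Sum.[ (λ (i , ¬l) → to T-not ¬l (⧏⇒leftWinsFirst (gl i) H (p i)))
    , (λ (j , ¬l) → to T-not ¬l (⧏⇒leftWinsFirst G (hr j) (q j))) ]
      (to (T-anyFin-splitAt (not ∘ leftWinsFirst) (λ i → negate (gl i) ⊕ H) (λ j → negate G ⊕ hr j)) t)

mutual
  leftWinsFirst⇒⧏ : ∀ G H → T (leftWinsFirst (negate G ⊕ H)) → G ⧏ H
  leftWinsFirst⇒⧏ G@(mk l r gl gr) H@(mk l′ r′ hl hr) t =
    Sum.map (λ (j , p) → j , ¬rightWinsFirst⇒≼ (gr j) H (to T-not p))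
            (λ (i , p) → i , ¬rightWinsFirst⇒≼ G (hl i) (to T-not p))
      (to (T-anyFin-splitAt (not ∘ rightWinsFirst) (λ j → negate (gr j) ⊕ H) (λ i → negate G ⊕ hl i)) t)

  ¬rightWinsFirst⇒≼ : ∀ G H → ¬ T (rightWinsFirst (negate G ⊕ H)) → G ≼ H
  ¬rightWinsFirst⇒≼ G@(mk l r gl gr) H@(mk l′ r′ hl hr) ¬t =
    (λ i → leftWinsFirst⇒⧏ (gl i) H (T-¬¬ λ ¬l → ¬t (opt (inj₁ (i , from T-not ¬l))))) ,
    (λ j → leftWinsFirst⇒⧏ G (hr j) (T-¬¬ λ ¬l → ¬t (opt (inj₂ (j , from T-not ¬l)))))
    where
    opt = from (T-anyFin-splitAt (not ∘ leftWinsFirst) (λ i → negate (gl i) ⊕ H) (λ j → negate G ⊕ hr j))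

_≼?_ : ∀ G H → Dec (G ≼ H)
G ≼? H = map′ (¬rightWinsFirst⇒≼ G H) (≼⇒¬rightWinsFirst G H) (¬? (T? _))

_⧏?_ : ∀ G H → Dec (G ⧏ H)
G ⧏? H = map′ (leftWinsFirst⇒⧏ G H) (⧏⇒leftWinsFirst G H) (T? _)

¬∀×∀⇒∃⊎∃ : ∀ {m n} {P : Fin m → Set} {Q : Fin n → Set} →
  (∀ i → Dec (P i)) → (∀ j → Dec (Q j)) →
  ¬ ((∀ i → P i) × (∀ j → Q j)) → (∃ λ j → ¬ Q j) ⊎ (∃ λ i → ¬ P i)
¬∀×∀⇒∃⊎∃ {Q = Q} P? Q? ¬PQ with all? P?
... | yes p = inj₁ (¬∀⟶∃¬ _ Q Q? (λ q → ¬PQ (p , q)))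
... | no ¬p = inj₂ (¬∀⟶∃¬ _ _ P? ¬p)

mutual
  -- Determinacy of finite games: if not all of Right's first moves can be answered, a search
  -- through the finitely many options finds one that cannot.
  ¬≼⇒⧏ : ∀ G H → ¬ G ≼ H → H ⧏ G
  ¬≼⇒⧏ G@(mk l r gl gr) H@(mk l′ r′ hl hr) G⋠H =
    Sum.map (λ (j , ¬q) → j , ¬⧏⇒≼ G (hr j) ¬q) (λ (i , ¬p) → i , ¬⧏⇒≼ (gl i) H ¬p)
      (¬∀×∀⇒∃⊎∃ (λ i → gl i ⧏? H) (λ j → G ⧏? hr j) G⋠H)

  ¬⧏⇒≼ : ∀ G H → ¬ G ⧏ H → H ≼ G
  ¬⧏⇒≼ G@(mk l r gl gr) H@(mk l′ r′ hl hr) ¬G⧏H =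
    (λ i → ¬≼⇒⧏ G (hl i) (λ p → ¬G⧏H (inj₂ (i , p)))) ,
    (λ j → ¬≼⇒⧏ (gr j) H (λ p → ¬G⧏H (inj₁ (j , p))))

-- A single test game suffices: in `negate X ⊕ X` the player to move loses, and `≈` transfers this
-- to `negate X ⊕ G`.
≈⇒≼ : ∀ {G X} → G ≈ X → G ≼ X
≈⇒≼ {G} {X} G≈X = ¬⧏⇒≼ X G λ X⧏G →
  ≼⇒¬⧏ (≼-refl X)
    (leftWinsFirst⇒⧏ X X (subst T (cong proj₁ (G≈X (negate X))) (⧏⇒leftWinsFirst X G X⧏G)))

≈⇒≽ : ∀ {G X} → G ≈ X → X ≼ G
≈⇒≽ {G} {X} G≈X = ¬rightWinsFirst⇒≼ X G λ t →
  ≼⇒¬rightWinsFirst X X (≼-refl X) (subst T (cong proj₂ (G≈X (negate X))) t)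

-- Negative integers and birthdays

minus : ℕ → Game
minus zero    = mk 0 0 (λ ()) (λ ())
minus (suc c) = mk 0 1 (λ ()) (λ _ → minus c)

≤-maxFin : ∀ {n} (f : Fin n → ℕ) i → f i ≤ maxFin n f
≤-maxFin f zero    = m≤n⇒m≤n⊔o _ ≤-refl
≤-maxFin f (suc i) = m≤n⇒m≤o⊔n _ (≤-maxFin (f ∘ suc) i)

maxFin-lub : ∀ {n k} (f : Fin n → ℕ) → (∀ i → f i ≤ k) → maxFin n f ≤ k
maxFin-lub {zero}  f f≤k = z≤n
maxFin-lub {suc n} f f≤k = ⊔-lub (f≤k zero) (maxFin-lub (f ∘ suc) (f≤k ∘ suc))

rightOption-birthday : ∀ {l r gl gr k} → birthday (mk l r gl gr) ≤ k → ∀ j → birthday (gr j) < k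
rightOption-birthday {l} {r} {gl} {gr} bd j =
  ≤-trans (≤-maxFin (suc ∘ birthday ∘ gr) j) (m⊔n≤o⇒n≤o (maxFin l (suc ∘ birthday ∘ gl)) _ bd)

birthday-minus : ∀ c → birthday (minus c) ≤ c
birthday-minus zero    = z≤n
birthday-minus (suc c) = ⊔-lub (s≤s (birthday-minus c)) z≤n

-- Right has at most `c` moves in `G`, and Left answers each of them with one of the `c` free moves
-- supplied by subtracting `minus c`.
minus≼ : ∀ {c} G → birthday G ≤ c → minus c ≼ G
minus≼ {zero}  (mk l r gl gr) bd =
  (λ ()) , λ j → contradiction (rightOption-birthday {l} {r} {gl} {gr} bd j) λ ()
minus≼ {suc c} (mk l r gl gr) bd =
  (λ ()) , λ j → viaᴿ zero (minus≼ (gr j) (s≤s⁻¹ (rightOption-birthday {l} {r} {gl} {gr} bd j)))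

AllRight : (Game → Set) → Game → Set
AllRight P (mk _ _ _ gr) = ∀ j → P (gr j)

rightOptions≽minus : ∀ {c} G → birthday G ≤ c → AllRight (minus c ≼_) G
rightOptions≽minus (mk l r gl gr) bd j =
  minus≼ (gr j) (<⇒≤ (rightOption-birthday {l} {r} {gl} {gr} bd j))

-- Positions of a coloured digraph

Subset : ℕ → Set
Subset n = Fin n → Bool

infix 4 _⊆_
_⊆_ : ∀ {n} → Subset n → Subset n → Set
p ⊆ q = ∀ {v} → T (p v) → T (q v)

_∩_ : ∀ {n} → Subset n → Subset n → Subset n
(p ∩ q) v = p v ∧ q v

∁ : ∀ {n} → Subset n → Subset n
∁ p v = not (p v)

bit : Bool → ℕ
bit true  = 1
bit false = 0

count : ∀ {n} → Subset n → ℕ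
count {zero}  p = 0
count {suc n} p = bit (p zero) + count (p ∘ suc)

bit-mono : ∀ {x y} → (T x → T y) → bit x ≤ bit y
bit-mono {false} {y}     f = z≤n
bit-mono {true}  {true}  f = ≤-refl
bit-mono {true}  {false} f = ⊥-elim (f tt)

count-mono : ∀ {n} {p q : Subset n} → p ⊆ q → count p ≤ count q
count-mono {zero}  p⊆q = z≤n
count-mono {suc n} {p} {q} p⊆q =
  +-mono-≤ (bit-mono {p zero} (p⊆q {zero})) (count-mono (λ {v} → p⊆q {suc v}))

count-strict : ∀ {n} {p q : Subset n} → p ⊆ q → ∀ v → T (q v) → ¬ T (p v) → count p < count q
count-strict {suc n} {p} {q} p⊆q zero qv ¬pv with p zero | q zero
... | true  | _     = ⊥-elim (¬pv tt)
... | false | true  = s≤s (count-mono (λ {v} → p⊆q {suc v}))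
count-strict {suc n} {p} {q} p⊆q (suc v) qv ¬pv =
  +-mono-≤-< (bit-mono {p zero} (p⊆q {zero})) (count-strict (λ {u} → p⊆q {suc u}) v qv ¬pv)

count-≤⇒⊇ : ∀ {n} {p q : Subset n} → p ⊆ q → count q ≤ count p → q ⊆ p
count-≤⇒⊇ {p = p} p⊆q q≤p {v} qv with T? (p v)
... | yes pv = pv
... | no ¬pv = contradiction (count-strict p⊆q v qv ¬pv) (≤⇒≯ q≤p)

count-∩-∁ : ∀ {n} (p q : Subset n) → count (p ∩ q) + count (p ∩ ∁ q) ≡ count p
count-∩-∁ {zero}  p q = refl
count-∩-∁ {suc n} p q with p zero | q zero | count-∩-∁ (p ∘ suc) (q ∘ suc)
... | true  | true  | eq = cong suc eq
... | true  | false | eq = trans (+-suc _ _) (cong suc eq)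
... | false | _     | eq = eq

count≤n : ∀ {n} (p : Subset n) → count p ≤ n
count≤n {zero}  p = z≤n
count≤n {suc n} p = +-mono-≤ (bit-mono {p zero} {true} _) (count≤n (p ∘ suc))

count-full : ∀ {n} → count {n} (λ _ → true) ≡ n
count-full {zero}  = refl
count-full {suc n} = cong suc (count-full {n})

nonempty : ∀ {n} {p : Subset n} v → T (p v) → 0 < count p
nonempty {p = p} v pv = ≤-trans (s≤s z≤n) (count-strict {p = λ _ → false} {q = p} (λ ()) v pv λ ())

count-empty : ∀ {n} (p : Subset n) → (∀ v → ¬ T (p v)) → count p ≡ 0
count-empty {zero}  p ∄ = refl
count-empty {suc n} p ∄ with p zero | ∄ zero
... | true  | ∄₀ = contradiction tt ∄₀
... | false | _  = count-empty (p ∘ suc) (∄ ∘ suc)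

count≤1 : ∀ {n} (p : Subset n) → (∀ i j → T (p i) → T (p j) → i ≡ j) → count p ≤ 1
count≤1 {zero}  p unique = z≤n
count≤1 {suc n} p unique with p zero | unique zero
... | true  | unique₀ = s≤s (≤-reflexive (count-empty (p ∘ suc) λ v t → contradiction (unique₀ (suc v) tt t) λ ()))
... | false | _ = count≤1 (p ∘ suc) λ i j t u → suc-injective (unique (suc i) (suc j) t u)

options : ∀ {n} → Subset n → List (Fin n)
options p = filterᵇ p (allFin _)

lookup-options : ∀ {n} (p : Subset n) i → T (p (lookup (options p) i))
lookup-options p i = proj₂ (∈-filter⁻ (T? ∘ p) {xs = allFin _} (∈-lookup i))

options-lookup : ∀ {n} (p : Subset n) v → T (p v) → ∃ λ i → v ≡ lookup (options p) i
options-lookup p v pv = index v∈ , lookup-index v∈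
  where
  v∈ : v ∈ options p
  v∈ = ∈-filter⁺ (T? ∘ p) (∈-allFin v) pv

module _ {n : ℕ} (D : ColouredDigraph n) where

  Blue Red : Subset n → Subset n
  Blue U = U ∩ blue D
  Red  U = U ∩ ∁ (blue D)

  ∖-⊆ : ∀ U v → deleteClosed D U v ⊆ U
  ∖-⊆ U v {u} t = proj₁ (to (T-∧ {U u}) t)

  ∖-∌ : ∀ U v → ¬ T (deleteClosed D U v v)
  ∖-∌ U v t = to T-not (proj₂ (to (T-∧ {U v}) t)) (from T-∨ (inj₁ (fromWitness {a? = v ≟ v} refl)))

  size-∖ : ∀ {U v k} → T (U v) → count U ≤ suc k → count (deleteClosed D U v) ≤ k
  size-∖ {U} {v} t le = s≤s⁻¹ (≤-trans (count-strict (∖-⊆ U v) v t (∖-∌ U v)) le)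

-- Pointwise agreement serves two purposes: `D` = `D′` compares positions of one digraph, and the
-- general case compares a digraph with the one decoded from its code.
module _ {n : ℕ} (D D′ : ColouredDigraph n)
         (blue≗ : ∀ v → blue D v ≡ blue D′ v) (arc≗ : ∀ v u → arc D v u ≡ arc D′ v u) where

  Blue-∖ : ∀ {U U′} v → Blue D U ⊆ Blue D′ U′ →
           Blue D (deleteClosed D U v) ⊆ Blue D′ (deleteClosed D′ U′ v)
  Blue-∖ {U} {U′} v sub {u} t with to (T-∧ {deleteClosed D U v u}) t
  ... | Uvu , b with to (T-∧ {U u}) Uvu
  ...   | Uu , c with to (T-∧ {U′ u}) (sub (from (T-∧ {U u}) (Uu , b)))
  ...     | U′u , b′ rewrite arc≗ v u = from (T-∧ {deleteClosed D′ U′ v u}) (from (T-∧ {U′ u}) (U′u , c) , b′)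

  Red-∖ : ∀ {U U′} v → Red D′ U′ ⊆ Red D U →
          Red D′ (deleteClosed D′ U′ v) ⊆ Red D (deleteClosed D U v)
  Red-∖ {U} {U′} v sub {u} t with to (T-∧ {deleteClosed D′ U′ v u}) t
  ... | Uvu , b with to (T-∧ {U′ u}) Uvu
  ...   | U′u , c with to (T-∧ {U u}) (sub (from (T-∧ {U′ u}) (U′u , b)))
  ...     | Uu , b′ rewrite sym (arc≗ v u) = from (T-∧ {deleteClosed D U v u}) (from (T-∧ {U u}) (Uu , c) , b′)

  -- Deleting a blue vertex only takes moves from Left, and deleting a red one only from Right.
  dpgPos-mono : ∀ k k′ {U U′} → count U ≤ k → count U′ ≤ k′ →
    Blue D U ⊆ Blue D′ U′ → Red D′ U′ ⊆ Red D U → dpgPos D k U ≼ dpgPos D′ k′ U′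
  dpgPos-mono zero zero _ _ _ _ = (λ ()) , (λ ())
  dpgPos-mono zero (suc k′) {U} {U′} U≤k _ _ red⊇ = (λ ()) , λ j →
    contradiction (nonempty {p = U} _ (proj₁ (to (T-∧ {U _}) (red⊇ (lookup-options (Red D′ U′) j))))) (≤⇒≯ U≤k)
  dpgPos-mono (suc k) zero {U} {U′} _ U′≤k blue⊆ _ = (λ i →
    contradiction (nonempty {p = U′} _ (proj₁ (to (T-∧ {U′ _}) (blue⊆ (lookup-options (Blue D U) i))))) (≤⇒≯ U′≤k))
    , (λ ())
  dpgPos-mono (suc k) (suc k′) {U} {U′} U≤k U′≤k blue⊆ red⊇ = left , right
    where
    step : ∀ {v} → T (U v) → T (U′ v) → dpgPos D k (deleteClosed D U v) ≼ dpgPos D′ k′ (deleteClosed D′ U′ v)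
    step {v} Uv U′v = dpgPos-mono k k′ (size-∖ D {U} Uv U≤k) (size-∖ D′ {U′} U′v U′≤k)
      (λ {u} → Blue-∖ {U} {U′} v blue⊆ {u}) (λ {u} → Red-∖ {U} {U′} v red⊇ {u})
    left : ∀ i → dpgPos D k (deleteClosed D U (lookup (options (Blue D U)) i)) ⧏ dpgPos D′ (suc k′) U′
    left i = let v = lookup (options (Blue D U)) i
                 Uv = lookup-options (Blue D U) i
                 i′ , eq = options-lookup (Blue D′ U′) v (blue⊆ Uv)
             in viaᴸ i′ (subst (λ x → _ ≼ dpgPos D′ k′ (deleteClosed D′ U′ x)) eq
                  (step (proj₁ (to (T-∧ {U v}) Uv)) (proj₁ (to (T-∧ {U′ v}) (blue⊆ Uv)))))
    right : ∀ j → dpgPos D (suc k) U ⧏ dpgPos D′ k′ (deleteClosed D′ U′ (lookup (options (Red D′ U′)) j))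
    right j = let v = lookup (options (Red D′ U′)) j
                  U′v = lookup-options (Red D′ U′) j
                  j′ , eq = options-lookup (Red D U) v (red⊇ U′v)
              in viaᴿ j′ (subst (λ x → dpgPos D k (deleteClosed D U x) ≼ _) eq
                   (step (proj₁ (to (T-∧ {U v}) (red⊇ U′v))) (proj₁ (to (T-∧ {U′ v}) U′v))))

-- Games with the single Right option −c

-- The vertices of `P` are peeled off one at a time, each taking away the at most `t` indices that
-- it covers. It will be applied with `P` the moves of Left and `I` the options still to be reached.
union-bound : ∀ {n N} (P : Subset n) (I : Subset N) (R : Fin n → Subset N) t →
  (∀ i → T (I i) → ∃ λ v → T (P v) × T (R v i)) →
  (∀ v → T (P v) → count (I ∩ R v) ≤ t) → count I ≤ count P * t
union-bound {zero} P I R t cov _ =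
  ≤-reflexive (count-empty I λ i Ii → contradiction (proj₁ (cov i Ii)) λ ())
union-bound {suc n} P I R t cov small with P zero in eq
... | true  = begin
  count I                                       ≡⟨ count-∩-∁ I (R zero) ⟨
  count (I ∩ R zero) + count (I ∩ ∁ (R zero))   ≤⟨ +-mono-≤ (small zero (subst T (sym eq) tt))
                                                     (union-bound (P ∘ suc) (I ∩ ∁ (R zero)) (R ∘ suc) t cov′ small′) ⟩
  t + count (P ∘ suc) * t                       ∎
  where
  open ≤-Reasoning
  cov′ : ∀ i → T ((I ∩ ∁ (R zero)) i) → ∃ λ v → T (P (suc v)) × T (R (suc v) i)
  cov′ i t with to (T-∧ {I i}) t
  ... | Ii , ¬R₀ with cov i Ii
  ...   | zero  , _  , R₀ = contradiction R₀ (to T-not ¬R₀)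
  ...   | suc v , Pv , Rv = v , Pv , Rv
  small′ : ∀ v → T (P (suc v)) → count ((I ∩ ∁ (R zero)) ∩ R (suc v)) ≤ t
  small′ v Pv = ≤-trans
    (count-mono λ {i} t → let (a , b) = to (T-∧ {(I ∩ ∁ (R zero)) i}) t
                          in from (T-∧ {I i}) (proj₁ (to (T-∧ {I i}) a) , b))
    (small (suc v) Pv)
... | false = union-bound (P ∘ suc) I (R ∘ suc) t cov′ (small ∘ suc)
  where
  cov′ : ∀ i → T (I i) → ∃ λ v → T (P (suc v)) × T (R (suc v) i)
  cov′ i Ii with cov i Ii
  ... | zero  , P₀ , _  = contradiction (subst T eq P₀) λ ()
  ... | suc v , Pv , Rv = v , Pv , Rv

module Positions {n : ℕ} (D : ColouredDigraph n) where

  B R : Subset n → Subset n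
  B = Blue D
  R = Red D

  infixl 7 _∖_
  _∖_ : Subset n → Fin n → Subset n
  _∖_ = deleteClosed D

  -- One unit of fuel more than needed makes pos U unfold to mk for every n.
  pos : Subset n → Game
  pos = dpgPos D (suc n)

  full : Subset n
  full _ = true

  B-∖ : ∀ {U W} v → B U ⊆ B W → B (U ∖ v) ⊆ B (W ∖ v)
  B-∖ {U} {W} v sub {u} = Blue-∖ D D (λ _ → refl) (λ _ _ → refl) {U} {W} v sub {u}

  R-∖ : ∀ {U W} v → R U ⊆ R W → R (U ∖ v) ⊆ R (W ∖ v)
  R-∖ {U} {W} v sub {u} = Red-∖ D D (λ _ → refl) (λ _ _ → refl) {W} {U} v sub {u}

  ∩-∖ : ∀ {U v} (q : Subset n) → (U ∖ v) ∩ q ⊆ U ∩ q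
  ∩-∖ {U} {v} q {u} t = let (a , b) = to (T-∧ {(U ∖ v) u}) t in from (T-∧ {U u}) (∖-⊆ D U v {u} a , b)

  count-∖ : ∀ {U v} (q : Subset n) → T ((U ∩ q) v) → count ((U ∖ v) ∩ q) < count (U ∩ q)
  count-∖ {U} {v} q t =
    count-strict (λ {u} → ∩-∖ {U} {v} q {u}) v t (λ x → ∖-∌ D U v (proj₁ (to (T-∧ {(U ∖ v) v}) x)))

  fuel-mono : ∀ {k k′ U W} → n ≤ k → n ≤ k′ → B U ⊆ B W → R W ⊆ R U → dpgPos D k U ≼ dpgPos D k′ W
  fuel-mono {U = U} {W} n≤k n≤k′ b r = dpgPos-mono D D (λ _ → refl) (λ _ _ → refl) _ _
    (≤-trans (count≤n U) n≤k) (≤-trans (count≤n W) n≤k′) b r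

  refuel : ∀ {k k′ U} → n ≤ k → n ≤ k′ → dpgPos D k U ≼ dpgPos D k′ U
  refuel {U = U} n≤k n≤k′ = fuel-mono {U = U} {U} n≤k n≤k′ id id

  pos-mono : ∀ {U W} → B U ⊆ B W → R W ⊆ R U → pos U ≼ pos W
  pos-mono {U} {W} = fuel-mono {U = U} {W} (n≤1+n n) (n≤1+n n)

  after : ∀ {U} → dpgPos D n U ≼ pos U
  after {U} = refuel {U = U} ≤-refl (n≤1+n n)

  before : ∀ {U} → pos U ≼ dpgPos D n U
  before {U} = refuel {U = U} (n≤1+n n) ≤-refl

  moveᴸ : ∀ {G U v} → T (B U v) → G ≼ pos (U ∖ v) → G ⧏ pos U
  moveᴸ {G} {U} {v} Uv p with options-lookup (B U) v Uv
  ... | i , eq = viaᴸ i (subst (λ x → G ≼ dpgPos D n (U ∖ x)) eq (≼-trans p (before {U ∖ v})))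

  moveᴿ : ∀ {H U w} → T (R U w) → pos (U ∖ w) ≼ H → pos U ⧏ H
  moveᴿ {H} {U} {w} Uw p with options-lookup (R U) w Uw
  ... | j , eq = viaᴿ j (subst (λ x → dpgPos D n (U ∖ x) ≼ H) eq (≼-trans (after {U ∖ w}) p))

  afterᴸ : ∀ {X U v} → pos U ≼ X → T (B U v) → pos (U ∖ v) ⧏ X
  afterᴸ {X} {U} {v} U≼X Uv = ¬≼⇒⧏ X (pos (U ∖ v)) λ p → ≼⇒¬⧏ U≼X (moveᴸ {U = U} Uv p)

  afterᴿ : ∀ {G U w} → G ≼ pos U → T (R U w) → G ⧏ pos (U ∖ w)
  afterᴿ {G} {U} {w} G≼U Uw = ¬≼⇒⧏ (pos (U ∖ w)) G λ p → ≼⇒¬⧏ G≼U (moveᴿ {U = U} Uw p)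

  ⧏-pos : ∀ G {U} → G ⧏ pos U → AllRight (λ Gʲ → ¬ Gʲ ≼ pos U) G →
          ∃ λ v → T (B U v) × G ≼ pos (U ∖ v)
  ⧏-pos (mk _ _ _ _) (inj₁ (j , p)) irr = contradiction p (irr j)
  ⧏-pos (mk _ _ _ _) {U} (inj₂ (i , p)) irr =
    lookup (options (B U)) i , lookup-options (B U) i , ≼-trans p (after {U ∖ lookup (options (B U)) i})

  pos-⧏ : ∀ {U l r hl hr} → pos U ⧏ mk l r hl hr →
          (∃ λ w → T (R U w) × pos (U ∖ w) ≼ mk l r hl hr) ⊎ (∃ λ i → pos U ≼ hl i)
  pos-⧏ {U} (inj₁ (j , p)) =
    inj₁ (lookup (options (R U)) j , lookup-options (R U) j , ≼-trans (before {U ∖ lookup (options (R U)) j}) p)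
  pos-⧏ (inj₂ q) = inj₂ q

  pos-⧏-minus : ∀ {U} c → pos U ⧏ minus c → ∃ λ w → T (R U w) × pos (U ∖ w) ≼ minus c
  pos-⧏-minus {U} zero    p with pos-⧏ {U} p
  ... | inj₁ q = q
  pos-⧏-minus {U} (suc c) p with pos-⧏ {U} p
  ... | inj₁ q = q

  -- Each step from `minus (suc c)` to `minus c` has to be matched by deleting a red vertex, because
  -- `minus c` offers Left no option.
  minus-count : ∀ c {U} → pos U ≼ minus c → c ≤ count (R U)
  minus-count zero    _ = z≤n
  minus-count (suc c) {U} p with pos-⧏-minus {U} c (proj₂ p zero)
  ... | w , Uw , q = ≤-trans (s≤s (minus-count c {U ∖ w} q)) (count-∖ {U} {w} (∁ (blue D)) Uw)

threat : ∀ {N} → ℕ → (Fin N → Game) → Game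
threat c A = mk _ 1 A (λ _ → minus c)

-- Bounds N for b blue and r red vertices, when every Aᵢ needs at least m blue ones; fuel ≥ r suffices.
capacity : (c m fuel b r : ℕ) → ℕ
capacity c m zero       b r = 0
capacity c m (suc fuel) b r =
  bit (c <ᵇ r) * (b * (bit (m <ᵇ b) ⊔ capacity c m fuel (b ∸ 2) (r ∸ 2)))

bit-T : ∀ {x} → T x → bit x ≡ 1
bit-T {true} _ = refl

<-<⇒≤∸2 : ∀ {x y z k} → x < y → y < z → z ≤ k → x ≤ k ∸ 2
<-<⇒≤∸2 x<y y<z z≤k = ∸-monoˡ-≤ 2 (≤-trans (s≤s x<y) (≤-trans y<z z≤k))

module _ (c m : ℕ) {N : ℕ} (A : Fin N → Game)
  (A-birthday : ∀ i → birthday (A i) ≤ c)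
  (A-antichain : ∀ i j → A i ≼ A j → i ≡ j)
  (A-blue : ∀ i {n} (D : ColouredDigraph n) U →
     dpgPos D (suc n) U ≼ A i → A i ≼ dpgPos D (suc n) U → m ≤ count (Blue D U)) where

  module _ {n : ℕ} (D : ColouredDigraph n) where
    open Positions D

    threatened : ∀ {U} → pos U ≼ threat c A → ∃ λ w → T (R U w) × pos (U ∖ w) ≼ minus c
    threatened {U} U≼X = pos-⧏-minus {U} c (proj₂ U≼X zero)

    safe : ∀ {U i} → A i ≼ pos U → ¬ pos U ⧏ minus c
    safe {U} {i} Ai≼U = ≼⇒¬⧏ (≼-trans (minus≼ (A i) (A-birthday i)) Ai≼U)

    -- A Right option of Aᵢ is at least -c, so it cannot lie below a position in which Right
    -- threatens -c. Hence Aᵢ ⧏ U can only be won by a Left move in U.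
    irreversible : ∀ {U} i → pos U ⧏ minus c → AllRight (λ G → ¬ G ≼ pos U) (A i)
    irreversible {U} i U⧏c with A i | A-birthday i
    ... | mk l r gl gr | bd = λ j p →
      ≼⇒¬⧏ (≼-trans (rightOptions≽minus (mk l r gl gr) bd j) p) U⧏c

    -- Otherwise the threat in U survives Left's move v.
    kills-red : ∀ {U v i} → pos U ≼ threat c A → A i ≼ pos (U ∖ v) → count (R (U ∖ v)) < count (R U)
    kills-red {U} {v} {i} U≼X Ai≼K = ≰⇒> λ le →
      let (w , Uw , thr) = threatened {U} U≼X
          keeps = count-≤⇒⊇ (λ {u} → ∩-∖ {U} {v} (∁ (blue D)) {u}) le
      in safe {U ∖ v} {i} Ai≼K (moveᴿ {U = U ∖ v} (keeps {w} Uw)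
           (≼-trans (pos-mono {U ∖ v ∖ w} {U ∖ w}
                       (λ {u} → B-∖ {U ∖ v} {U} w (λ {u} → ∩-∖ {U} {v} (blue D) {u}) {u})
                       (λ {u} → R-∖ {U} {U ∖ v} w keeps {u}))
                    thr))

    -- Otherwise the threat in U ∖ w is already present in U.
    kills-blue : ∀ {U w i} → pos (U ∖ w) ≼ threat c A → A i ≼ pos U → count (B (U ∖ w)) < count (B U)
    kills-blue {U} {w} {i} H≼X Ai≼K = ≰⇒> λ le →
      let (x , Hx , thr) = threatened {U ∖ w} H≼X
          keeps = count-≤⇒⊇ (λ {u} → ∩-∖ {U} {w} (blue D) {u}) le
      in safe {U} {i} Ai≼K (moveᴿ {U = U} (∩-∖ {U} {w} (∁ (blue D)) {x} Hx)
           (≼-trans (pos-mono {U ∖ x} {U ∖ w ∖ x}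
                       (λ {u} → B-∖ {U} {U ∖ w} x keeps {u})
                       (λ {u} → R-∖ {U ∖ w} {U} x (λ {u} → ∩-∖ {U} {w} (∁ (blue D)) {u}) {u}))
                    thr))

    -- Every i in `I` is served by one of at most `b` Left moves v, leading to K ≽ Aᵢ. Since K ⧏ X,
    -- either K ≼ Aⱼ for some j, and the antichain leaves i = j only, or Right replies from K to a
    -- position ≼ X. That position satisfies the same hypotheses with two vertices fewer of each
    -- colour, for all the indices served by v.
    count≤capacity : ∀ fuel b r U (I : Subset N) → r ≤ fuel → count (B U) ≤ b → count (R U) ≤ r →
      pos U ≼ threat c A → (∀ i → T (I i) → A i ⧏ pos U) → count I ≤ capacity c m fuel b r
    count≤capacity fuel b r U I r≤fuel B≤b R≤r U≼X covers
      with threatened {U} U≼X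
    -- At least `c` red vertices survive the deletion of w₀, so `r` exceeds `c` and the first factor
    -- of `capacity` is 1.
    ... | w₀ , Uw₀ , thr
      with <-≤-trans (s≤s (minus-count c {U ∖ w₀} thr)) (≤-trans (count-∖ {U} {w₀} (∁ (blue D)) Uw₀) R≤r)
    ... | c<r with fuel
    ...   | zero = contradiction (<-≤-trans c<r r≤fuel) λ ()
    ...   | suc fuel′ rewrite bit-T (<⇒<ᵇ c<r) = begin
      count I            ≤⟨ union-bound (B U) I (λ v i → ⌊ A i ≼? pos (U ∖ v) ⌋) t exists small ⟩
      count (B U) * t    ≤⟨ *-monoˡ-≤ t B≤b ⟩
      b * t              ≡⟨ +-identityʳ (b * t) ⟨
      b * t + 0          ∎
      where
      open ≤-Reasoning
      t = bit (m <ᵇ b) ⊔ capacity c m fuel′ (b ∸ 2) (r ∸ 2)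

      exists : ∀ i → T (I i) → ∃ λ v → T (B U v) × T ⌊ A i ≼? pos (U ∖ v) ⌋
      exists i Ii with ⧏-pos (A i) {U} (covers i Ii) (irreversible {U} i (proj₂ U≼X zero))
      ... | v , Uv , p = v , Uv , fromWitness p

      I′ : Fin n → Subset N
      I′ v = I ∩ (λ i → ⌊ A i ≼? pos (U ∖ v) ⌋)

      I′⇒≼ : ∀ v i → T (I′ v i) → A i ≼ pos (U ∖ v)
      I′⇒≼ v i s = toWitness (proj₂ (to (T-∧ {I i}) s))

      small : ∀ v → T (B U v) → count (I′ v) ≤ t
      -- The vertex counts need an actual Aᵢ below the position after v; a move serving no index
      -- contributes nothing.
      small v Uv with any? (λ i → T? (I′ v i))
      ... | no ∄ = ≤-trans (≤-reflexive (count-empty (I′ v) λ i s → ∄ (i , s))) z≤n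
      ... | yes (i , s) with pos-⧏ {U ∖ v} (afterᴸ {U = U} U≼X Uv)
      ...   | inj₁ (w , Kw , H≼X) = ≤-trans
        (count≤capacity fuel′ (b ∸ 2) (r ∸ 2) (U ∖ v ∖ w) (I′ v) (≤-trans (∸-monoˡ-≤ 2 r≤fuel) (m∸n≤m fuel′ 1))
          (<-<⇒≤∸2 (kills-blue {U ∖ v} {w} {i} H≼X (I′⇒≼ v i s)) (count-∖ {U} {v} (blue D) Uv) B≤b)
          (<-<⇒≤∸2 (count-∖ {U ∖ v} {w} (∁ (blue D)) Kw) (kills-red {U} {v} {i} U≼X (I′⇒≼ v i s)) R≤r)
          H≼X (λ k s′ → afterᴿ {U = U ∖ v} (I′⇒≼ v k s′) Kw))
        (m≤n⊔m (bit (m <ᵇ b)) _)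
      ...   | inj₂ (j , K≼Aj) = ≤-trans
        (count≤1 (I′ v) λ i₁ i₂ s₁ s₂ → trans (leaf i₁ s₁) (sym (leaf i₂ s₂)))
        (≤-trans (≤-reflexive (sym (bit-T (<⇒<ᵇ m<b)))) (m≤m⊔n _ _))
        where
        leaf : ∀ k → T (I′ v k) → k ≡ j
        leaf k s = A-antichain k j (≼-trans (I′⇒≼ v k s) K≼Aj)
        m<b : m < b
        -- Here K equals Aⱼ, so `m` blue vertices remain after the blue vertex v is deleted.
        m<b = ≤-trans (s≤s (A-blue j D (U ∖ v) K≼Aj (subst (λ k → A k ≼ pos (U ∖ v)) (leaf i s) (I′⇒≼ v i s))))
                (≤-trans (count-∖ {U} {v} (blue D) Uv) B≤b)

  -- A digraph on at most `k` vertices with b blue ones has at most k - b red ones, so the finitely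
  -- many values of b can be checked by evaluation.
  capacity⇒fAtLeast : ∀ k →
    True (all? λ (b : Fin (suc k)) → capacity c m k (toℕ b) (k ∸ toℕ b) <? N) →
    fAtLeast (threat c A) (suc k)
  capacity⇒fAtLeast k small n D D≈X = ≰⇒> λ n≤k →
    let open Positions D
        b = count (B full)
        r = count (R full)
        b+r≡n = trans (count-∩-∁ full (blue D)) (count-full {n})
        b<1+k = s≤s (≤-trans (count≤n (B full)) n≤k)
        r≤k∸b = ≤-trans (≤-reflexive (sym (m+n∸m≡n b r)))
                  (∸-monoˡ-≤ b (≤-trans (≤-reflexive b+r≡n) n≤k))
        N≤capacity = count≤capacity D k b (k ∸ b) full (λ _ → true) (m∸n≤m k b) ≤-refl r≤k∸b
          (≼-trans (before {full}) (≈⇒≼ D≈X)) (λ i _ → proj₁ (≼-trans (≈⇒≽ D≈X) (after {full})) i)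
        capacity<N = subst (λ x → capacity c m k x (k ∸ x) < N) (toℕ-fromℕ< b<1+k)
          (toWitness small (fromℕ< b<1+k))
    in <-irrefl refl (≤-<-trans (subst (_≤ _) (count-full {N}) N≤capacity) capacity<N)

threat-born : ∀ {c N} (A : Fin N → Game) → (∀ i → birthday (A i) ≤ c) → birthday (threat c A) ≤ suc c
threat-born A bd = ⊔-lub (maxFin-lub _ (λ i → s≤s (bd i))) (⊔-lub (s≤s (birthday-minus _)) z≤n)

bornBy : ∀ {b X} → birthday X ≤ b → BornBy b X
bornBy {X = X} bd = X , bd , λ _ → refl

-- Counting digraphs against games

⧏-leftOption : ∀ G {l r hl hr} → G ⧏ mk l r hl hr → AllRight (λ Gʲ → ¬ Gʲ ≼ mk l r hl hr) G →
               ∃ λ i → G ≼ hl i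
⧏-leftOption (mk _ _ _ _) (inj₁ (j , p)) irr = contradiction p (irr j)
⧏-leftOption (mk _ _ _ _) (inj₂ q)       irr = q

record Antichain (c a : ℕ) : Set where
  field
    member    : Fin a → Game
    born      : ∀ i → birthday (member i) ≤ c
    antichain : ∀ i j → member i ≼ member j → i ≡ j
    ⋠minus    : ∀ i → ¬ member i ≼ minus c

  -- The excluded options are replaced by −c, which lies above no member.
  choice : (Fin a → Bool) → Fin a → Game
  choice f i = if f i then member i else minus c

  subgame : (Fin a → Bool) → Game
  subgame f = threat c (choice f)

  choice-born : ∀ f i → birthday (choice f i) ≤ c
  choice-born f i with f i
  ... | true  = born i
  ... | false = birthday-minus c

  subgame-born : ∀ f → birthday (subgame f) ≤ suc c
  subgame-born f = threat-born (choice f) (choice-born f)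

  ⧏-subgame : ∀ f i → T (f i) → member i ⧏ subgame f
  ⧏-subgame f i fi = viaᴸ i chosen
    where
    chosen : member i ≼ choice f i
    chosen with f i
    ... | true = ≼-refl (member i)

  irreversible′ : ∀ f i → AllRight (λ G → ¬ G ≼ subgame f) (member i)
  irreversible′ f i with member i | born i
  ... | mk l r gl gr | bd = λ j p →
    ≼⇒¬⧏ (≼-trans (rightOptions≽minus (mk l r gl gr) bd j) p) (viaᴿ zero (≼-refl (minus c)))

  -- The Right options of a member are at least -c and so not below the subgame, from which Right
  -- can move to -c. Thus some Left option lies above `member i`; it is not the placeholder -c, and
  -- by the antichain property it is `member i` itself.
  subgame-⧏ : ∀ f i → member i ⧏ subgame f → T (f i)
  subgame-⧏ f i p with ⧏-leftOption (member i) p (irreversible′ f i)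
  ... | j , q with f j in eq
  ...   | true  = subst (T ∘ f) (sym (antichain i j q)) (subst T (sym eq) tt)
  ...   | false = contradiction q (⋠minus i)

  -- The index guarantees a Left option; even the placeholder -c is at least -(c + 1), so moving
  -- there refutes the inequality.
  subgame-⋠minus : Fin a → ∀ f → ¬ subgame f ≼ minus (suc c)
  subgame-⋠minus i f p =
    ≼⇒¬⧏ (minus≼ (choice f i) (≤-trans (choice-born f i) (n≤1+n c))) (proj₁ p i)

-- Antichains of exponential size from subsets

open Antichain

restrict : ∀ {c a a′} → a′ ≤ a → Antichain c a → Antichain c a′
restrict a′≤a 𝔸 = record
  { member    = λ i → member 𝔸 (inject≤ i a′≤a)
  ; born      = λ i → born 𝔸 (inject≤ i a′≤a)
  ; antichain = λ i j p → inject≤-injective a′≤a a′≤a i j (antichain 𝔸 _ _ p)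
  ; ⋠minus    = λ i → ⋠minus 𝔸 (inject≤ i a′≤a)
  }

open Inverse 2↔Bool using () renaming (to to toBool; from to fromBool)

bits : ∀ a → Fin (2 ^ a) → Fin a → Bool
bits a x i = toBool (finToFun x i)

unbits : ∀ {a} → (Fin a → Bool) → Fin (2 ^ a)
unbits f = funToFin (fromBool ∘ f)

funToFin-cong : ∀ {m n} {f g : Fin m → Fin n} → f ≗ g → funToFin f ≡ funToFin g
funToFin-cong {zero}  eq = refl
funToFin-cong {suc m} eq = cong₂ combine (eq zero) (funToFin-cong (eq ∘ suc))

bits-unbits : ∀ {a} (f : Fin a → Bool) → bits a (unbits f) ≗ f
bits-unbits f i =
  trans (cong toBool (finToFun-funToFin (fromBool ∘ f) i)) (Inverse.strictlyInverseˡ 2↔Bool (f i))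

unbits-unique : ∀ {a} (f : Fin a → Bool) x → f ≗ bits a x → unbits f ≡ x
unbits-unique {a} f x eq = trans
  (funToFin-cong λ i → trans (cong fromBool (eq i)) (Inverse.strictlyInverseʳ 2↔Bool (finToFun {2} {a} x i)))
  (funToFin-finToFin {a} {2} x)

bits-injective : ∀ {a} x y → bits a x ≗ bits a y → x ≡ y
bits-injective {a} x y eq = trans (sym (unbits-unique (bits a x) x λ _ → refl)) (unbits-unique (bits a x) y eq)

-- The converse implication is stated for complements, the form in which `doubled` supplies it.
T-ext : ∀ {x y} → (T x → T y) → (T (not x) → T (not y)) → x ≡ y
T-ext {true}  {true}  _ _ = refl
T-ext {false} {false} _ _ = refl
T-ext {true}  {false} f _ = contradiction (f tt) λ ()
T-ext {false} {true}  _ g = contradiction (g tt) λ ()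

-- An inequality between subgames gives inclusion of the chosen sets, and the half holding
-- complements turns inclusion into equality. The element `z` provides the index that
-- `subgame-⋠minus` asks for.
power : ∀ {c h} → Fin h → Antichain c (h + h) → Antichain (suc c) (2 ^ h)
power {c} {h} z 𝔸 = record
  { member    = λ x → subgame 𝔸 (doubled x)
  ; born      = λ x → subgame-born 𝔸 (doubled x)
  ; antichain = λ x y p → bits-injective x y λ i → T-ext
      (subst₂ (λ a b → T a → T b) (inl x i) (inl y i) (transfer x y p (i ↑ˡ h)))
      (subst₂ (λ a b → T a → T b) (inr x i) (inr y i) (transfer x y p (h ↑ʳ i)))
  ; ⋠minus    = λ x → subgame-⋠minus 𝔸 (z ↑ˡ h) (doubled x)
  }
  where
  -- Joining the complement of the subset makes any two choices incomparable.
  doubled : Fin (2 ^ h) → Fin (h + h) → Bool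
  doubled x k = Sum.[ bits h x , not ∘ bits h x ] (splitAt h k)
  inl : ∀ x i → doubled x (i ↑ˡ h) ≡ bits h x i
  inl x i = cong Sum.[ bits h x , not ∘ bits h x ] (splitAt-↑ˡ h i h)
  inr : ∀ x i → doubled x (h ↑ʳ i) ≡ not (bits h x i)
  inr x i = cong Sum.[ bits h x , not ∘ bits h x ] (splitAt-↑ʳ h h i)
  transfer : ∀ x y → subgame 𝔸 (doubled x) ≼ subgame 𝔸 (doubled y) →
             ∀ k → T (doubled x k) → T (doubled y k)
  transfer x y p k t = subgame-⧏ 𝔸 (doubled y) k (⧏-≼-trans (⧏-subgame 𝔸 (doubled x) k t) p)

-- Pigeonhole principle and codes of digraphs

missed : ∀ {m n} (f : Fin m → Fin n) → m < n → ∃ λ y → ∀ x → f x ≢ y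
missed {m} {n} f m<n with ¬∀⟶∃¬ n (λ y → ∃ λ x → f x ≡ y) (λ y → any? (λ x → f x ≟ y)) ¬onto
  where
  ¬onto : ¬ (∀ y → ∃ λ x → f x ≡ y)
  ¬onto onto with pigeonhole m<n (proj₁ ∘ onto)
  ... | i , j , i<j , eq =
    <⇒≢ i<j (cong toℕ (trans (sym (proj₂ (onto i))) (trans (cong f eq) (proj₂ (onto j)))))
... | y , ¬hit = y , λ x fx≡y → ¬hit (x , fx≡y)

missed× : ∀ {k l n} (f : Fin k × Fin l → Fin n) → k * l < n → ∃ λ y → ∀ z → f z ≢ y
missed× {k} {l} f kl<n with missed (f ∘ remQuot {k} l) kl<n
... | y , miss = y , λ (i , j) eq → miss (combine i j) (trans (cong f (remQuot-combine i j)) eq)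

-- Column 0 of the N × (1 + N) bit matrix holds the colours, column 1 + u the arcs into u.
decode : ∀ {n N} → n ≤ N → Fin (2 ^ (N * suc N)) → ColouredDigraph n
decode {n} {N} n≤N x = record
  { blue = λ v → bits (N * suc N) x (combine (inject≤ v n≤N) zero)
  ; arc  = λ v u → bits (N * suc N) x (combine (inject≤ v n≤N) (suc (inject≤ u n≤N)))
  }

-- Padding with `false` lets digraphs of all sizes up to N share one set of codes.
extend : ∀ {n N} → (Fin n → Bool) → Fin N → Bool
extend {n} f v with toℕ v <? n
... | yes v<n = f (fromℕ< v<n)
... | no  _   = false

extend-inject≤ : ∀ {n N} (f : Fin n → Bool) (n≤N : n ≤ N) v → extend f (inject≤ v n≤N) ≡ f v
extend-inject≤ {n} f n≤N v with toℕ (inject≤ v n≤N) <? n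
... | yes p = cong f (trans (fromℕ<-cong _ _ (toℕ-inject≤ v n≤N) p (toℕ<n v)) (fromℕ<-toℕ v (toℕ<n v)))
... | no ¬p = contradiction (subst (_< n) (sym (toℕ-inject≤ v n≤N)) (toℕ<n v)) ¬p

row : ∀ {n N} → ColouredDigraph n → Fin (suc N) → Fin n → Bool
row D zero    v = blue D v
row D (suc u) v = extend (arc D v) u

encode : ∀ {n} N → ColouredDigraph n → Fin (2 ^ (N * suc N))
encode N D = unbits λ x → extend (row D (proj₂ (remQuot {N} (suc N) x))) (proj₁ (remQuot {N} (suc N) x))

bits-encode : ∀ {n N} (D : ColouredDigraph n) (n≤N : n ≤ N) v u →
  bits (N * suc N) (encode N D) (combine (inject≤ v n≤N) u) ≡ row D u v
bits-encode {N = N} D n≤N v u = begin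
  bits (N * suc N) (encode N D) (combine (inject≤ v n≤N) u)
    ≡⟨ bits-unbits {N * suc N} _ (combine (inject≤ v n≤N) u) ⟩
  extend (row D (proj₂ (remQuot {N} (suc N) (combine (inject≤ v n≤N) u)))) (proj₁ (remQuot {N} (suc N) (combine (inject≤ v n≤N) u)))
    ≡⟨ cong (λ (v , u) → extend (row D u) v) (remQuot-combine (inject≤ v n≤N) u) ⟩
  extend (row D u) (inject≤ v n≤N)
    ≡⟨ extend-inject≤ (row D u) n≤N v ⟩
  row D u v ∎
  where open ≡-Reasoning

dpg-cong : ∀ {n} {D D′ : ColouredDigraph n} →
  (∀ v → blue D v ≡ blue D′ v) → (∀ v u → arc D v u ≡ arc D′ v u) → dpg D ≼ dpg D′
dpg-cong {n} {D} {D′} blue≗ arc≗ =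
  dpgPos-mono D D′ blue≗ arc≗ n n {λ _ → true} {λ _ → true} (count≤n {n} _) (count≤n {n} _)
    (λ {v} → subst T (blue≗ v)) (λ {v} → subst (T ∘ not) (sym (blue≗ v)))

n<2^n : ∀ n → n < 2 ^ n
n<2^n zero    = s≤s z≤n
n<2^n (suc n) = ≤-trans (+-mono-≤ (m^n>0 2 n) (n<2^n n)) (+-monoʳ-≤ (2 ^ n) (m≤m+n (2 ^ n) 0))

module _ {c a : ℕ} (𝔸 : Antichain c a) (N : ℕ) where

  -- This depends only on the value of the game, and on a subgame it returns the chosen subset.
  signature : Game → Fin (2 ^ a)
  signature G = unbits λ i → ⌊ member 𝔸 i ⧏? G ⌋

  decoded : Fin (suc N) × Fin (2 ^ (N * suc N)) → Game
  decoded (m , x) = dpg (decode (s≤s⁻¹ (toℕ<n m)) x)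

  signature-subgame : ∀ {G} y → G ≼ subgame 𝔸 (bits a y) → subgame 𝔸 (bits a y) ≼ G → signature G ≡ y
  signature-subgame {G} y G≼X X≼G = unbits-unique _ y agree
    where
    agree : ∀ i → ⌊ member 𝔸 i ⧏? G ⌋ ≡ bits a y i
    agree i = T-ext
      (λ t → subgame-⧏ 𝔸 (bits a y) i (⧏-≼-trans (toWitness t) G≼X))
      (λ t → from T-not λ yᵢ → to T-not t (fromWitness (⧏-≼-trans (⧏-subgame 𝔸 (bits a y) i yᵢ) X≼G)))

  decoded-encode : ∀ (m : Fin (suc N)) (D : ColouredDigraph (toℕ m)) →
    decoded (m , encode N D) ≼ dpg D × dpg D ≼ decoded (m , encode N D)
  decoded-encode m D = dpg-cong blue≗ arc≗ , dpg-cong (sym ∘ blue≗) (λ v u → sym (arc≗ v u))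
    where
    n≤N = s≤s⁻¹ (toℕ<n m)
    blue≗ : ∀ v → blue (decode n≤N (encode N D)) v ≡ blue D v
    blue≗ v = bits-encode D n≤N v zero
    arc≗ : ∀ v u → arc (decode n≤N (encode N D)) v u ≡ arc D v u
    arc≗ v u = trans (bits-encode D n≤N v (suc (inject≤ u n≤N))) (extend-inject≤ (arc D v) n≤N u)

  missed⇒≉ : ∀ y → (∀ z → signature (decoded z) ≢ y) →
    ∀ {n} (m : Fin (suc N)) → toℕ m ≡ n → (D : ColouredDigraph n) → ¬ dpg D ≈ subgame 𝔸 (bits a y)
  missed⇒≉ y miss m refl D D≈X = miss (m , encode N D) (signature-subgame y
    (≼-trans (proj₁ (decoded-encode m D)) (≈⇒≼ D≈X)) (≼-trans (≈⇒≽ D≈X) (proj₂ (decoded-encode m D))))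

  missed⇒FAtLeast : (∃ λ y → ∀ z → signature (decoded z) ≢ y) → FAtLeast (suc c) (suc N)
  missed⇒FAtLeast (y , miss) = subgame 𝔸 (bits a y) , bornBy (subgame-born 𝔸 (bits a y)) ,
    λ n D D≈X → ≮⇒≥ λ n<N → missed⇒≉ y miss (fromℕ< n<N) (toℕ-fromℕ< n<N) D D≈X

  -- The size of the digraph costs a factor N + 1 < 2^(N + 1), and the exponents add up to (N + 1)².
  codes<signatures : suc N * suc N ≤ a → suc N * 2 ^ (N * suc N) < 2 ^ a
  codes<signatures N²≤a = begin-strict
    suc N * 2 ^ (N * suc N)       <⟨ *-monoˡ-< (2 ^ (N * suc N)) {{m^n≢0 2 (N * suc N)}} (n<2^n (suc N)) ⟩
    2 ^ suc N * 2 ^ (N * suc N)   ≡⟨ ^-distribˡ-+-* 2 (suc N) (N * suc N) ⟨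
    2 ^ (suc N + N * suc N)       ≤⟨ ^-monoʳ-≤ 2 N²≤a ⟩
    2 ^ a                         ∎
    where open ≤-Reasoning

  antichain⇒FAtLeast : suc N * suc N ≤ a → FAtLeast (suc c) (suc N)
  antichain⇒FAtLeast N²≤a = missed⇒FAtLeast (missed× (signature ∘ decoded) (codes<signatures N²≤a))

-- Growth along the tower

-- Taking h = 2^(t + 1) in `power` uses 2^(t + 2) members, which are available among 2^(2t) once t ≥
-- 2. The exponent keeps the shape t + t, with 2^t for t.
power² : ∀ {c t} → 2 ≤ t → Antichain c (2 ^ (t + t)) → Antichain (suc c) (2 ^ (2 ^ t + 2 ^ t))
power² {c} {t} 2≤t 𝔸 = subst (λ x → Antichain (suc c) (2 ^ x)) (double t)
  (power {h = 2 ^ suc t} (fromℕ< (m^n>0 2 (suc t))) (restrict small 𝔸))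
  where
  double : ∀ n → 2 ^ suc n ≡ 2 ^ n + 2 ^ n
  double n = cong (2 ^ n +_) (+-identityʳ (2 ^ n))
  small : 2 ^ suc t + 2 ^ suc t ≤ 2 ^ (t + t)
  small = ≤-trans (≤-reflexive (sym (double (suc t)))) (^-monoʳ-≤ 2 (+-monoˡ-≤ t 2≤t))

tower>0 : ∀ k → 1 ≤ tower 2 k
tower>0 zero    = ≤-refl
tower>0 (suc k) = m^n>0 2 (tower 2 k)

2≤tower : ∀ k → 2 ≤ tower 2 (suc k)
2≤tower k = ^-monoʳ-≤ 2 (tower>0 k)

-- The counting bound needs the square of the number of vertices, and 2^(t + t) is the square of
-- 2^t.
antichain²⇒FAtLeast : ∀ {c t} → Antichain c (2 ^ (t + t)) → FAtLeast (suc c) (2 ^ t)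
antichain²⇒FAtLeast {c} {t} 𝔸 = go (2 ^ t) (m^n>0 2 t) (≤-reflexive (sym (^-distribˡ-+-* 2 t t)))
  where
  go : ∀ N → 1 ≤ N → N * N ≤ 2 ^ (t + t) → FAtLeast (suc c) N
  go (suc N) _ le = antichain⇒FAtLeast 𝔸 N le

-- The games born by day 3

⟨_∣_⟩ : List Game → List Game → Game
⟨ L ∣ R ⟩ = mk (length L) (length R) (lookup L) (lookup R)

𝟘 𝟙 -𝟙 𝟚 ½ -½ ∗ ∗2 𝟙∗ -𝟙∗ ↑ ↓ ↑∗ ↓∗ ±𝟙 𝟙∣𝟘 𝟙∣∗ 𝟙∣𝟘∗ 𝟘∣-𝟙 ∗∣-𝟙 𝟘∗∣-𝟙 : Game
𝟘     = ⟨ [] ∣ [] ⟩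
𝟙     = ⟨ [ 𝟘 ] ∣ [] ⟩
-𝟙    = ⟨ [] ∣ [ 𝟘 ] ⟩
∗     = ⟨ [ 𝟘 ] ∣ [ 𝟘 ] ⟩
𝟚     = ⟨ [ 𝟙 ] ∣ [] ⟩
½     = ⟨ [ 𝟘 ] ∣ [ 𝟙 ] ⟩
-½    = ⟨ [ -𝟙 ] ∣ [ 𝟘 ] ⟩
∗2    = ⟨ 𝟘 ∷ ∗ ∷ [] ∣ 𝟘 ∷ ∗ ∷ [] ⟩
𝟙∗    = ⟨ [ 𝟙 ] ∣ [ 𝟙 ] ⟩
-𝟙∗   = ⟨ [ -𝟙 ] ∣ [ -𝟙 ] ⟩
↑     = ⟨ [ 𝟘 ] ∣ [ ∗ ] ⟩
↓     = ⟨ [ ∗ ] ∣ [ 𝟘 ] ⟩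
↑∗    = ⟨ 𝟘 ∷ ∗ ∷ [] ∣ [ 𝟘 ] ⟩
↓∗    = ⟨ [ 𝟘 ] ∣ 𝟘 ∷ ∗ ∷ [] ⟩
±𝟙    = ⟨ [ 𝟙 ] ∣ [ -𝟙 ] ⟩
𝟙∣𝟘   = ⟨ [ 𝟙 ] ∣ [ 𝟘 ] ⟩
𝟙∣∗   = ⟨ [ 𝟙 ] ∣ [ ∗ ] ⟩
𝟙∣𝟘∗  = ⟨ [ 𝟙 ] ∣ 𝟘 ∷ ∗ ∷ [] ⟩
𝟘∣-𝟙  = ⟨ [ 𝟘 ] ∣ [ -𝟙 ] ⟩
∗∣-𝟙  = ⟨ [ ∗ ] ∣ [ -𝟙 ] ⟩
𝟘∗∣-𝟙 = ⟨ 𝟘 ∷ ∗ ∷ [] ∣ [ -𝟙 ] ⟩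

allRight? : ∀ {P : Game → Set} → (∀ G → Dec (P G)) → ∀ G → Dec (AllRight P G)
allRight? P? (mk _ _ _ gr) = all? (λ j → P? (gr j))

-- An irreversible Left option above which Left still has two more moves in hand
Deep : Game → Set
Deep s@(mk _ _ sl _) = ∃ λ i → 𝟙 ⧏ sl i × AllRight (λ G → ¬ G ≼ s) (sl i)

deep? : ∀ s → Dec (Deep s)
deep? s@(mk _ _ sl _) = any? λ i → (𝟙 ⧏? sl i) ×-dec allRight? (λ G → ¬? (G ≼? s)) (sl i)

AllRight-map : ∀ {P Q : Game → Set} → (∀ {G} → P G → Q G) → ∀ G → AllRight P G → AllRight Q G
AllRight-map f (mk _ _ _ _) p j = f (p j)

-- Left has three moves in a row, each deleting a blue vertex: to a position above the irreversible
-- option, from there to one above 1, and once more.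
deep⇒3≤blue : ∀ s → Deep s → ∀ {n} (D : ColouredDigraph n) U →
  dpgPos D (suc n) U ≼ s → s ≼ dpgPos D (suc n) U → 3 ≤ count (Blue D U)
deep⇒3≤blue s@(mk _ _ sl _) (i , 𝟙⧏sⁱ , irr) {n} D U U≼s s≼U = three
  where
  open Positions D
  three : 3 ≤ count (B U)
  three with ⧏-pos (sl i) {U} (proj₁ s≼U i) (AllRight-map (λ ¬G≼s G≼U → ¬G≼s (≼-trans G≼U U≼s)) (sl i) irr)
  ... | v₁ , Uv₁ , sⁱ≼U₁ with ⧏-pos 𝟙 {U ∖ v₁} (⧏-≼-trans 𝟙⧏sⁱ sⁱ≼U₁) (λ ())
  ...   | v₂ , Uv₂ , 𝟙≼U₂ with ⧏-pos 𝟘 {U ∖ v₁ ∖ v₂} (proj₁ 𝟙≼U₂ zero) (λ ())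
  ...     | v₃ , Uv₃ , _ =
    ≤-trans (s≤s (≤-trans (s≤s (nonempty {p = B (U ∖ v₁ ∖ v₂)} v₃ Uv₃))
                          (count-∖ {U ∖ v₁} {v₂} (blue D) Uv₂)))
      (count-∖ {U} {v₁} (blue D) Uv₁)

-- Found by a computer search for a large antichain of deep games in the order on games born by day 3
day3List : List Game
day3List =
  cartesianProductWith ⟨_∣_⟩
    ((𝟙 ∷ 𝟙∣𝟘 ∷ []) ∷ (𝟙 ∷ 𝟙∣∗ ∷ []) ∷ (½ ∷ 𝟙∣𝟘 ∷ 𝟙∣∗ ∷ []) ∷ [])
    ((-𝟙 ∷ 𝟘∗∣-𝟙 ∷ []) ∷ (𝟘∣-𝟙 ∷ -½ ∷ []) ∷ (𝟘∣-𝟙 ∷ ∗∣-𝟙 ∷ []) ∷ (-½ ∷ ∗∣-𝟙 ∷ []) ∷ []) ++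
  cartesianProductWith ⟨_∣_⟩
    ((𝟙 ∷ 𝟙∣𝟘∗ ∷ []) ∷ (½ ∷ 𝟙∣𝟘 ∷ []) ∷ (½ ∷ 𝟙∣∗ ∷ []) ∷ (𝟙∣𝟘 ∷ 𝟙∣∗ ∷ []) ∷ [])
    ((-𝟙 ∷ []) ∷ (↓∗ ∷ ∗∣-𝟙 ∷ []) ∷ (𝟘∣-𝟙 ∷ ↓ ∷ []) ∷ (𝟘∗∣-𝟙 ∷ -½ ∷ []) ∷ []) ++
  cartesianProductWith ⟨_∣_⟩
    ((½ ∷ 𝟙∣𝟘∗ ∷ []) ∷ (↑ ∷ 𝟙∣𝟘 ∷ []) ∷ (↑∗ ∷ 𝟙∣∗ ∷ []) ∷ [])
    ((𝟘 ∷ 𝟘∣-𝟙 ∷ []) ∷ (∗ ∷ ∗∣-𝟙 ∷ []) ∷ (↓∗ ∷ 𝟘∗∣-𝟙 ∷ ↓ ∷ []) ∷ (-½ ∷ []) ∷ []) ++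
  cartesianProductWith ⟨_∣_⟩
    ((𝟘 ∷ 𝟙∣𝟘 ∷ []) ∷ (∗ ∷ 𝟙∣∗ ∷ []) ∷ (↑ ∷ ↑∗ ∷ 𝟙∣𝟘∗ ∷ []) ∷ [])
    ((𝟘 ∷ ↓∗ ∷ 𝟘∗∣-𝟙 ∷ []) ∷ (∗ ∷ 𝟘∗∣-𝟙 ∷ ↓ ∷ []) ∷ (↓∗ ∷ ↓ ∷ []) ∷ []) ++
  cartesianProductWith ⟨_∣_⟩
    ((𝟘 ∷ ↑∗ ∷ 𝟙∣𝟘∗ ∷ []) ∷ (∗ ∷ ↑ ∷ 𝟙∣𝟘∗ ∷ []) ∷ [])
    ((𝟘 ∷ ∗ ∷ 𝟘∗∣-𝟙 ∷ []) ∷ (𝟘 ∷ ↓∗ ∷ []) ∷ (∗ ∷ ↓ ∷ []) ∷ []) ++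
  cartesianProductWith ⟨_∣_⟩
    ((𝟙 ∷ 𝟙∣𝟘 ∷ 𝟙∣∗ ∷ []) ∷ (𝟙∗ ∷ []) ∷ [])
    ((-𝟙 ∷ 𝟘∣-𝟙 ∷ []) ∷ (-𝟙 ∷ ∗∣-𝟙 ∷ []) ∷ (𝟘∣-𝟙 ∷ -½ ∷ ∗∣-𝟙 ∷ []) ∷ []) ++
  cartesianProductWith ⟨_∣_⟩
    ((𝟙 ∷ 𝟙∗ ∷ []) ∷ [])
    ((-𝟙∗ ∷ []) ∷ (-𝟙 ∷ 𝟘∣-𝟙 ∷ ∗∣-𝟙 ∷ []) ∷ []) ++
  ⟨ [ 𝟚 ] ∣ -𝟙 ∷ -𝟙∗ ∷ [] ⟩ ∷ []

day3 : Fin 64 → Game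
day3 = lookup day3List

day3-antichain : ∀ i j → day3 i ≼ day3 j → i ≡ j
day3-antichain = toWitness {a? = all? λ i → all? λ j → (day3 i ≼? day3 j) →-dec (i ≟ j)} tt

day3-birthday : ∀ i → birthday (day3 i) ≤ 3
day3-birthday = toWitness {a? = all? λ i → birthday (day3 i) ≤? 3} tt

day3-deep : ∀ i → Deep (day3 i)
day3-deep = toWitness {a? = all? λ i → deep? (day3 i)} tt

day3-⋠minus : ∀ i → ¬ day3 i ≼ minus 3
day3-⋠minus = toWitness {a? = all? λ i → ¬? (day3 i ≼? minus 3)} tt

-- The bounds for each day

zeroes : Fin 1 → Game
zeroes _ = 𝟘

f≥2 : FAtLeast 2 2
f≥2 = threat 1 zeroes , bornBy (threat-born zeroes λ _ → z≤n) ,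
  capacity⇒fAtLeast 1 0 zeroes (λ _ → z≤n) (λ { zero zero _ → refl }) (λ _ _ _ _ _ → z≤n) 1 tt

f≥4 : FAtLeast 3 4
f≥4 = threat 2 zeroes , bornBy (threat-born zeroes λ _ → z≤n) ,
  capacity⇒fAtLeast 2 0 zeroes (λ _ → z≤n) (λ { zero zero _ → refl }) (λ _ _ _ _ _ → z≤n) 3 tt

f≥16 : FAtLeast 4 16
f≥16 = threat 3 day3 , bornBy (threat-born day3 day3-birthday) ,
  -- The worst split of 15 is 9 blue and 6 red vertices, allowing 9 · 7 = 63 options. With m < 3, a
  -- split into 7 and 8 would allow 7 · 5 · 3 = 105.
  capacity⇒fAtLeast 3 3 day3 day3-birthday day3-antichain
    (λ i → deep⇒3≤blue (day3 i) (day3-deep i)) 15 tt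

day3Antichain : Antichain 3 (32 + 32)
day3Antichain = record
  { member    = day3
  ; born      = day3-birthday
  ; antichain = day3-antichain
  ; ⋠minus    = day3-⋠minus
  }

-- The base has 2^32 games, and 32 = 16 + 16 with 16 = `tower 2 3`; each later day replaces the
-- exponent's t by 2^t, the next tower.
towerAntichain : Antichain 3 (32 + 32) → ∀ k → Antichain (4 + k) (2 ^ (tower 2 (3 + k) + tower 2 (3 + k)))
towerAntichain 𝔸 zero    = power {h = 32} zero 𝔸
towerAntichain 𝔸 (suc k) = power² (2≤tower (2 + k)) (towerAntichain 𝔸 k)

f≥tower : Antichain 3 (32 + 32) → ∀ k → FAtLeast (5 + k) (tower 2 (4 + k))
f≥tower 𝔸 k = antichain²⇒FAtLeast {t = tower 2 (3 + k)} (towerAntichain 𝔸 k)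

theorem11 : (b : ℕ) → 2 ≤ b → FAtLeast b (tower 2 (b ∸ 1))
theorem11 1 (s≤s ())
theorem11 2 _ = f≥2
theorem11 3 _ = f≥4
theorem11 4 _ = f≥16
theorem11 (suc (suc (suc (suc (suc k))))) _ = f≥tower day3Antichain k
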